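{- If $K$ is a $P$-complex of rank $n$ and $\sigma$ is a face simplex of $K$ of rank $k$, then $\mathrm{link}_K\,\sigma$ is a $P$-complex of rank $n-k$.
   Context: For a finite simplicial complex $K$, let $M(K)$ be the set of its inclusion-maximal simplices. A simplex $\tau\in K$ is a face simplex if $\tau=\sigma_1\cap\dots\cap\sigma_s$ for some $\sigma_1,\dots,\sigma_s\in M(K)$ ($s\ge1$). $F(K)$ denotes the set of all face simplices, ordered by inclusion. $K$ is called a polytopic complex ($P$-complex) of rank $n$ if: (1) $\varnothing\in F(K)$, i.e. the intersection of all maximal simplices is empty; (2) $F(K)$ is a graded poset of rank $n$, i.e. all its inclusion-maximal chains have the same number $n+1$ of elements, so that a rank function $\mathrm{rk}$ is defined with $\mathrm{rk}(\varnothing)=0$, with $\mathrm{rk}$ increasing by $1$ along covering relations, and with $\mathrm{rk}(\sigma)=n$ for maximal simplices $\sigma$; (3) for every $\sigma\in F(K)$ there is a simplicial subcomplex $Z_\sigma$ of $\mathrm{link}_K\sigma$ such that (the geometric realization of) $Z_\sigma$ is homeomorphic to the sphere $S^{n-\mathrm{rk}(\sigma)-1}$ and $Z_\sigma$ is a strong deformation retract of $\mathrm{link}_K\sigma$; here $\mathrm{link}_K\varnothing=K$ and $S^{ -1}=\varnothing$. The rank of a face simplex is its value under $\mathrm{rk}$. As usual $\mathrm{link}_K\sigma=\{\tau\in K\mid\tau\cap\sigma=\varnothing,\ \tau\cup\sigma\in K\}$. -}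

module Defs where

open import Data.Fin.Subset
  using (Subset; ⊥; _∈_; _⊆_; _⊂_; _∩_; _∪_; ⋂)
open import Data.Fin.Subset.Properties
  using (⊆-antisym; ⊆-min; ∪-identityˡ; ∩-zeroˡ; x∈p∩q⁺; x∈p∩q⁻; x∈p∪q⁺; x∈p∪q⁻)
open import Data.List.Base using (List; _∷_; length)
import Data.List.Relation.Binary.Subset.Propositional as ListSubset
open import Data.List.Relation.Unary.All using (All)
open import Data.List.Relation.Unary.AllPairs using (AllPairs)
open import Data.Nat.Base as ℕ using (ℕ; zero; suc)
import Data.Nat.Properties as ℕ
open import Data.Product using (Σ; ∃; _×_; _,_; proj₁)
open import Data.Rational.Base as ℚ using (ℚ; 0ℚ; 1ℚ; ½; 1/_; ∣_∣)
import Data.Rational.Properties as ℚ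
open import Data.Rational.Solver using (module +-*-Solver)
open import Data.Sum using (inj₁; inj₂; [_,_]′)
open import Data.Vec.Functional using (Vector; head; tail; foldr; map)
open import Data.Vec.Properties using (≡-dec)
import Data.Bool.Properties as Bool
open import Level using (0ℓ)
open import Relation.Binary.PropositionalEquality
  using (_≡_; refl; sym; trans; cong; subst)
open import Relation.Nullary using (¬_; _×-dec_)
open import Relation.Unary using (Pred; Decidable)

-- Real numbers, as Cauchy sequences of rationals.

Cauchy : (ℕ → ℚ) → Set
Cauchy s = ∀ ε → 0ℚ ℚ.< ε →
  ∃ λ N → ∀ i j → N ℕ.≤ i → N ℕ.≤ j → ∣ s i ℚ.- s j ∣ ℚ.< ε

abstract
  half-pos : ∀ {ε} → 0ℚ ℚ.< ε → 0ℚ ℚ.< ½ ℚ.* ε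
  half-pos {ε} 0<ε =
    subst (ℚ._< ½ ℚ.* ε) (ℚ.*-zeroʳ ½) (ℚ.*-monoʳ-<-pos ½ 0<ε)

  half+half : ∀ ε → ½ ℚ.* ε ℚ.+ ½ ℚ.* ε ≡ ε
  half+half ε =
    trans (sym (ℚ.*-distribʳ-+ ε ½ ½)) (ℚ.*-identityˡ ε)

  +-cauchy : ∀ s t → Cauchy s → Cauchy t → Cauchy (λ i → s i ℚ.+ t i)
  +-cauchy s t cs ct ε 0<ε
    with M , s-close ← cs (½ ℚ.* ε) (half-pos 0<ε)
    with N , t-close ← ct (½ ℚ.* ε) (half-pos 0<ε)
    = M ℕ.⊔ N , λ i j ≤i ≤j → begin-strict
      ∣ (s i ℚ.+ t i) ℚ.- (s j ℚ.+ t j) ∣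
        ≡⟨ cong ∣_∣ (rearrange (s i) (t i) (s j) (t j)) ⟩
      ∣ (s i ℚ.- s j) ℚ.+ (t i ℚ.- t j) ∣
        ≤⟨ ℚ.∣p+q∣≤∣p∣+∣q∣ (s i ℚ.- s j) (t i ℚ.- t j) ⟩
      ∣ s i ℚ.- s j ∣ ℚ.+ ∣ t i ℚ.- t j ∣
        <⟨ ℚ.+-mono-<
             (s-close i j (ℕ.m⊔n≤o⇒m≤o M N ≤i) (ℕ.m⊔n≤o⇒m≤o M N ≤j))
             (t-close i j (ℕ.m⊔n≤o⇒n≤o M N ≤i) (ℕ.m⊔n≤o⇒n≤o M N ≤j)) ⟩
      ½ ℚ.* ε ℚ.+ ½ ℚ.* ε
        ≡⟨ half+half ε ⟩
      ε ∎
    where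
    open ℚ.≤-Reasoning
    open +-*-Solver
    rearrange : ∀ a b c d →
      (a ℚ.+ b) ℚ.- (c ℚ.+ d) ≡ (a ℚ.- c) ℚ.+ (b ℚ.- d)
    rearrange = solve 4
      (λ a b c d → (a :+ b) :- (c :+ d) := (a :- c) :+ (b :- d)) refl

  bounded : ∀ {s} → Cauchy s →
    ∃ λ N → ∃ λ B → 0ℚ ℚ.< B × (∀ i → N ℕ.≤ i → ∣ s i ∣ ℚ.≤ B)
  bounded {s} cs with N , close ← cs 1ℚ (ℚ.positive⁻¹ 1ℚ) =
    N , 1ℚ ℚ.+ ∣ s N ∣
      , ℚ.+-mono-<-≤ (ℚ.positive⁻¹ 1ℚ) (ℚ.0≤∣p∣ (s N))
      , λ i N≤i → begin
      ∣ s i ∣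
        ≡⟨ cong ∣_∣ (split (s i) (s N)) ⟩
      ∣ (s i ℚ.- s N) ℚ.+ s N ∣
        ≤⟨ ℚ.∣p+q∣≤∣p∣+∣q∣ (s i ℚ.- s N) (s N) ⟩
      ∣ s i ℚ.- s N ∣ ℚ.+ ∣ s N ∣
        ≤⟨ ℚ.+-monoˡ-≤ ∣ s N ∣ (ℚ.<⇒≤ (close i N N≤i ℕ.≤-refl)) ⟩
      1ℚ ℚ.+ ∣ s N ∣ ∎
    where
    open ℚ.≤-Reasoning
    open +-*-Solver
    split : ∀ a b → a ≡ (a ℚ.- b) ℚ.+ b
    split = solve 2 (λ a b → a := (a :- b) :+ b) refl

  scale : ∀ C ε → 0ℚ ℚ.< C → 0ℚ ℚ.< ε → ∃ λ δ → 0ℚ ℚ.< δ × C ℚ.* δ ≡ ε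
  scale C ε 0<C 0<ε =
      1/ C ℚ.* ε
    , subst (ℚ._< 1/ C ℚ.* ε) (ℚ.*-zeroʳ (1/ C)) (ℚ.*-monoʳ-<-pos (1/ C) 0<ε)
    , trans (sym (ℚ.*-assoc C (1/ C) ε))
        (trans (cong (ℚ._* ε) (ℚ.*-inverseʳ C)) (ℚ.*-identityˡ ε))
    where
    instance
      C-pos : ℚ.Positive C
      C-pos = ℚ.positive 0<C

      C-nonZero : ℚ.NonZero C
      C-nonZero = ℚ.pos⇒nonZero C

      1/C-pos : ℚ.Positive (1/ C)
      1/C-pos = ℚ.1/pos⇒pos C

  *-bound : ∀ {C δ ε} u v → 0ℚ ℚ.< C → C ℚ.* δ ≡ ε →
    ∣ u ∣ ℚ.≤ C → ∣ v ∣ ℚ.< δ → ∣ u ℚ.* v ∣ ℚ.< ε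
  *-bound {C} {δ} {ε} u v 0<C Cδ≡ε u≤ v< = begin-strict
    ∣ u ℚ.* v ∣       ≡⟨ ℚ.∣p*q∣≡∣p∣*∣q∣ u v ⟩
    ∣ u ∣ ℚ.* ∣ v ∣   ≤⟨ ℚ.*-monoʳ-≤-nonNeg ∣ v ∣ {{ℚ.nonNegative (ℚ.0≤∣p∣ v)}} u≤ ⟩
    C ℚ.* ∣ v ∣       <⟨ ℚ.*-monoʳ-<-pos C {{ℚ.positive 0<C}} v< ⟩
    C ℚ.* δ           ≡⟨ Cδ≡ε ⟩
    ε                 ∎
    where open ℚ.≤-Reasoning

  *-close : ∀ {C δ η ε} a b c d → 0ℚ ℚ.< C → C ℚ.* δ ≡ η → η ℚ.+ η ≡ ε →
    ∣ a ∣ ℚ.≤ C → ∣ d ∣ ℚ.≤ C → ∣ a ℚ.- c ∣ ℚ.< δ → ∣ b ℚ.- d ∣ ℚ.< δ →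
    ∣ a ℚ.* b ℚ.- c ℚ.* d ∣ ℚ.< ε
  *-close {C} {δ} {η} {ε} a b c d 0<C Cδ≡η η+η≡ε a≤ d≤ ac< bd< = begin-strict
    ∣ a ℚ.* b ℚ.- c ℚ.* d ∣
      ≡⟨ cong ∣_∣ (rearrange a b c d) ⟩
    ∣ a ℚ.* (b ℚ.- d) ℚ.+ d ℚ.* (a ℚ.- c) ∣
      ≤⟨ ℚ.∣p+q∣≤∣p∣+∣q∣ (a ℚ.* (b ℚ.- d)) (d ℚ.* (a ℚ.- c)) ⟩
    ∣ a ℚ.* (b ℚ.- d) ∣ ℚ.+ ∣ d ℚ.* (a ℚ.- c) ∣
      <⟨ ℚ.+-mono-< (*-bound a (b ℚ.- d) 0<C Cδ≡η a≤ bd<)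
                    (*-bound d (a ℚ.- c) 0<C Cδ≡η d≤ ac<) ⟩
    η ℚ.+ η
      ≡⟨ η+η≡ε ⟩
    ε ∎
    where
    open ℚ.≤-Reasoning
    open +-*-Solver
    rearrange : ∀ a b c d →
      a ℚ.* b ℚ.- c ℚ.* d ≡ a ℚ.* (b ℚ.- d) ℚ.+ d ℚ.* (a ℚ.- c)
    rearrange = solve 4
      (λ a b c d → a :* b :- c :* d := a :* (b :- d) :+ d :* (a :- c)) refl

  *-cauchy : ∀ s t → Cauchy s → Cauchy t → Cauchy (λ i → s i ℚ.* t i)
  *-cauchy s t cs ct ε 0<ε =
    let M₀ , A , 0<A , s-bound = bounded cs
        N₀ , B , _ , t-bound   = bounded ct
        0<C                    = ℚ.<-≤-trans 0<A (ℚ.p≤p⊔q A B)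
        δ , 0<δ , Cδ≡½ε        = scale (A ℚ.⊔ B) (½ ℚ.* ε) 0<C (half-pos 0<ε)
        M₁ , s-close           = cs δ 0<δ
        N₁ , t-close           = ct δ 0<δ
    in (M₀ ℕ.⊔ N₀) ℕ.⊔ (M₁ ℕ.⊔ N₁) , λ i j ≤i ≤j →
      let i₀ = ℕ.m⊔n≤o⇒m≤o (M₀ ℕ.⊔ N₀) (M₁ ℕ.⊔ N₁) ≤i
          i₁ = ℕ.m⊔n≤o⇒n≤o (M₀ ℕ.⊔ N₀) (M₁ ℕ.⊔ N₁) ≤i
          j₀ = ℕ.m⊔n≤o⇒m≤o (M₀ ℕ.⊔ N₀) (M₁ ℕ.⊔ N₁) ≤j
          j₁ = ℕ.m⊔n≤o⇒n≤o (M₀ ℕ.⊔ N₀) (M₁ ℕ.⊔ N₁) ≤j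
      in *-close (s i) (t i) (s j) (t j) 0<C Cδ≡½ε (half+half ε)
           (ℚ.≤-trans (s-bound i (ℕ.m⊔n≤o⇒m≤o M₀ N₀ i₀)) (ℚ.p≤p⊔q A B))
           (ℚ.≤-trans (t-bound j (ℕ.m⊔n≤o⇒n≤o M₀ N₀ j₀)) (ℚ.p≤q⊔p A B))
           (s-close i j (ℕ.m⊔n≤o⇒m≤o M₁ N₁ i₁) (ℕ.m⊔n≤o⇒m≤o M₁ N₁ j₁))
           (t-close i j (ℕ.m⊔n≤o⇒n≤o M₁ N₁ i₁) (ℕ.m⊔n≤o⇒n≤o M₁ N₁ j₁))

  const-cauchy : ∀ q → Cauchy (λ _ → q)
  const-cauchy q ε 0<ε =
    0 , λ _ _ _ _ → subst (λ p → ∣ p ∣ ℚ.< ε) (sym (ℚ.+-inverseʳ q)) 0<ε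

record ℝ : Set where
  constructor mkℝ
  field
    seq    : ℕ → ℚ
    cauchy : Cauchy seq

open ℝ

infix  4 _≈_ _<_ _≤_
infixl 6 _+_
infixl 7 _*_

_≈_ : ℝ → ℝ → Set
x ≈ y = ∀ ε → 0ℚ ℚ.< ε → ∃ λ N → ∀ i → N ℕ.≤ i → ∣ seq x i ℚ.- seq y i ∣ ℚ.< ε

_<_ : ℝ → ℝ → Set
x < y = ∃ λ ε → 0ℚ ℚ.< ε × (∃ λ N → ∀ i → N ℕ.≤ i → seq x i ℚ.+ ε ℚ.< seq y i)

_≤_ : ℝ → ℝ → Set
x ≤ y = ¬ (y < x)

fromℚ : ℚ → ℝ
fromℚ q = mkℝ (λ _ → q) (const-cauchy q)

0ℝ 1ℝ : ℝ
0ℝ = fromℚ 0ℚ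
1ℝ = fromℚ 1ℚ

_+_ : ℝ → ℝ → ℝ
x + y = mkℝ (λ i → seq x i ℚ.+ seq y i) (+-cauchy (seq x) (seq y) (cauchy x) (cauchy y))

_*_ : ℝ → ℝ → ℝ
x * y = mkℝ (λ i → seq x i ℚ.* seq y i) (*-cauchy (seq x) (seq y) (cauchy x) (cauchy y))

-- Subspaces of Euclidean space, with the topology of the sup metric.

ℝ^_ : ℕ → Set
ℝ^ m = Vector ℝ m

sum : ∀ {m} → ℝ^ m → ℝ
sum = foldr _+_ 0ℝ

_≋_ : ∀ {m} → ℝ^ m → ℝ^ m → Set
x ≋ y = ∀ i → x i ≈ y i

Within : ∀ {m} → ℝ → ℝ^ m → ℝ^ m → Set
Within ε x y = ∀ i → (x i < y i + ε) × (y i < x i + ε)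

Subspace : ℕ → Set₁
Subspace m = Pred (ℝ^ m) 0ℓ

Point : ∀ {m} → Subspace m → Set
Point X = Σ _ X

-- A continuous map respects _≋_ automatically: points that are equal are
-- within every positive distance of each other, hence so are their images.
Continuous : ∀ {m n} {X : Subspace m} {Y : Subspace n} → (Point X → Point Y) → Set
Continuous {X = X} f = ∀ (p : Point X) ε → 0ℝ < ε →
  ∃ λ δ → 0ℝ < δ × (∀ q → Within δ (proj₁ p) (proj₁ q) →
                          Within ε (proj₁ (f p)) (proj₁ (f q)))

record Homeomorphism {m n} (X : Subspace m) (Y : Subspace n) : Set where
  field
    to              : Point X → Point Y
    from            : Point Y → Point X
    to-continuous   : Continuous to
    from-continuous : Continuous from
    to∘from         : ∀ q → proj₁ (to (from q)) ≋ proj₁ q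
    from∘to         : ∀ p → proj₁ (from (to p)) ≋ proj₁ p

-- The unit sphere of ℝ^ d, that is S^(d−1).  For d = 0 it is empty, since the
-- empty sum is 0.
UnitSphere : (d : ℕ) → Subspace d
UnitSphere d x = sum (map (λ a → a * a) x) ≈ 1ℝ

-- [0,1] × X, the parameter being the first coordinate.
Cylinder : ∀ {m} → Subspace m → Subspace (suc m)
Cylinder X x = (0ℝ ≤ head x × head x ≤ 1ℝ) × X (tail x)

record StrongDeformationRetract {m} (A X : Subspace m) : Set where
  field
    A⊆X        : ∀ {x} → A x → X x
    H          : Point (Cylinder X) → Point X
    continuous : Continuous H
    start      : ∀ p → head (proj₁ p) ≈ 0ℝ → proj₁ (H p) ≋ tail (proj₁ p)
    end        : ∀ p → head (proj₁ p) ≈ 1ℝ → A (proj₁ (H p))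
    fixed      : ∀ p → A (tail (proj₁ p)) → proj₁ (H p) ≋ tail (proj₁ p)

-- Finite simplicial complexes.  Elements of the ambient Fin m need not be
-- vertices, so a complex and its links and subcomplexes share the same m.

record Complex (m : ℕ) : Set₁ where
  field
    Simplex     : Pred (Subset m) 0ℓ
    simplex?    : Decidable Simplex
    ∅-simplex   : Simplex ⊥
    down-closed : ∀ {ρ τ} → Simplex τ → ρ ⊆ τ → Simplex ρ

open Complex

_⊑_ : ∀ {m} → Complex m → Complex m → Set
Z ⊑ K = ∀ {τ} → Simplex Z τ → Simplex K τ

-- Barycentric coordinates whose support is a simplex.  Real numbers have no
-- decidable order, so the support is not computed; the condition says that
-- every set of vertices with positive coordinates is a simplex.
Realization : ∀ {m} → Complex m → Subspace m
Realization K x =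
    (∀ i → 0ℝ ≤ x i)
  × sum x ≈ 1ℝ
  × (∀ τ → (∀ {i} → i ∈ τ → 0ℝ < x i) → Simplex K τ)

link : ∀ {m} (K : Complex m) (σ : Subset m) → Simplex K σ → Complex m
link K σ σ∈K = record
  { Simplex     = λ τ → τ ∩ σ ≡ ⊥ × Simplex K (τ ∪ σ)
  ; simplex?    = λ τ → ≡-dec Bool._≟_ (τ ∩ σ) ⊥ ×-dec simplex? K (τ ∪ σ)
  ; ∅-simplex   = ∩-zeroˡ σ , subst (Simplex K) (sym (∪-identityˡ σ)) σ∈K
  ; down-closed = λ {ρ} {τ} (τ∩σ≡∅ , τ∪σ∈K) ρ⊆τ →
        ⊆-antisym
          (λ x∈ρ∩σ → let x∈ρ , x∈σ = x∈p∩q⁻ ρ σ x∈ρ∩σ in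
            subst (_ ∈_) τ∩σ≡∅ (x∈p∩q⁺ (ρ⊆τ x∈ρ , x∈σ)))
          (⊆-min (ρ ∩ σ))
      , down-closed K τ∪σ∈K
          (λ x∈ρ∪σ → x∈p∪q⁺
            ([ (λ x∈ρ → inj₁ (ρ⊆τ x∈ρ)) , inj₂ ]′ (x∈p∪q⁻ ρ σ x∈ρ∪σ)))
  }

module _ {m} (K : Complex m) where

  Maximal : Pred (Subset m) 0ℓ
  Maximal σ = Simplex K σ × (∀ {τ} → Simplex K τ → σ ⊆ τ → τ ≡ σ)

  record FaceSimplex (τ : Subset m) : Set where
    field
      simplex        : Simplex K τ
      σ₁             : Subset m
      σs             : List (Subset m)
      all-maximal    : All Maximal (σ₁ ∷ σs)
      isIntersection : τ ≡ ⋂ (σ₁ ∷ σs)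

  -- A finite chain in the poset of face simplices, listed in increasing order.
  Chain : Pred (List (Subset m)) 0ℓ
  Chain c = All FaceSimplex c × AllPairs _⊂_ c

  MaximalChain : Pred (List (Subset m)) 0ℓ
  MaximalChain c =
    Chain c × (∀ d → Chain d → c ListSubset.⊆ d → d ListSubset.⊆ c)

  Graded : ℕ → Set
  Graded n = ∀ c → MaximalChain c → length c ≡ suc n

  Covers : Subset m → Subset m → Set
  Covers ρ τ = FaceSimplex ρ × FaceSimplex τ × ρ ⊂ τ
    × (∀ {υ} → FaceSimplex υ → ¬ (ρ ⊂ υ × υ ⊂ τ))

  -- The graph of the rank function.  When ∅ is a face simplex and the poset of
  -- face simplices is graded of rank n, every face simplex has exactly one
  -- rank, and the maximal simplices have rank n.
  data HasRank : Subset m → ℕ → Set where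
    rank-∅   : HasRank ⊥ 0
    rank-suc : ∀ {ρ τ k} → HasRank ρ k → Covers ρ τ → HasRank τ (suc k)

  record IsPComplex (n : ℕ) : Set₁ where
    field
      ∅-face : FaceSimplex ⊥
      graded : Graded n
      sphere : ∀ {σ k} (σ-face : FaceSimplex σ) → HasRank σ k →
        let L = link K σ (FaceSimplex.simplex σ-face) in
        ∃ λ (Z : Complex m) →
            Z ⊑ L
          × Homeomorphism (Realization Z) (UnitSphere (n ℕ.∸ k))
          × StrongDeformationRetract (Realization Z) (Realization L)

-- Adding σ to a simplex identifies the face simplices of link_K σ with the
-- face simplices of K that contain σ.  A maximal chain of the link therefore
-- becomes a maximal chain of K once a saturated chain of length k from ∅ up to
-- σ is put below it, and the link of τ in link_K σ is the link of τ ∪ σ in K,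
-- whose rank is that of τ plus k.

module Submission where

open import Defs
open import Data.Nat.Base as ℕ using (ℕ; _∸_; suc)
open import Data.Fin.Subset
  using (Subset; ⊥; _∈_; _∉_; _⊆_; _⊂_; _∩_; _∪_; _─_; ⋂; outside)
open import Data.Fin.Subset.Properties
open import Data.List.Base using (List; []; _∷_; _++_; _∷ʳ_; map; filter; length)
open import Data.List.Membership.Propositional using () renaming (_∈_ to _∈ˡ_)
open import Data.List.Membership.Propositional.Properties
  using (∈-map⁺; ∈-filter⁺; ∈-++⁺ˡ; ∈-++⁺ʳ)
open import Data.List.Properties using (length-++; length-map)
import Data.List.Relation.Binary.Subset.Propositional as ListSubset
open import Data.List.Relation.Unary.All as All using (All; []; _∷_)
import Data.List.Relation.Unary.All.Properties as All
open import Data.List.Relation.Unary.AllPairs using (AllPairs; []; _∷_)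
import Data.List.Relation.Unary.AllPairs.Properties as AllPairs
open import Data.List.Relation.Unary.Any using (here; there)
import Data.Nat.Properties as ℕ
open import Data.Product using (∃; _×_; _,_; proj₁; proj₂; uncurry)
open import Data.Sum using (_⊎_; inj₁; inj₂; [_,_]′)
open import Data.Vec.Base using (here; there; _∷_)
open import Function.Base using (_∘_)
open import Relation.Binary.PropositionalEquality
  using (_≡_; refl; sym; trans; cong; subst; subst₂; module ≡-Reasoning)
open import Relation.Nullary using (yes; no; contradiction)

open Complex
open FaceSimplex

-- Lists with pairwise related entries.

module _ {a b p r s} {A : Set a} {B : Set b} {P : A → Set p}
  {R : A → A → Set r} {S : B → B → Set s} {f : A → B} where

  -- `P` is carried along because adding `σ` keeps an inclusion strict when the larger set is
  -- disjoint from `σ`, and removing it does so when the smaller set contains `σ`.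
  AllPairs-map⁺ : (∀ {x y} → P x → P y → R x y → S (f x) (f y)) →
    ∀ {xs} → All P xs → AllPairs R xs → AllPairs S (map f xs)
  AllPairs-map⁺ g []         []         = []
  AllPairs-map⁺ g (px ∷ pxs) (rx ∷ rxs) =
    All.map⁺ (All.zipWith (uncurry (g px)) (pxs , rx)) ∷ AllPairs-map⁺ g pxs rxs

AllPairs-compare : ∀ {a r} {A : Set a} {R : A → A → Set r} {xs x y} →
  AllPairs R xs → x ∈ˡ xs → y ∈ˡ xs → R x y ⊎ x ≡ y ⊎ R y x
AllPairs-compare _          (here refl) (here refl) = inj₂ (inj₁ refl)
AllPairs-compare (rx ∷ _)   (here refl) (there y∈)  = inj₁ (All.lookup rx y∈)
AllPairs-compare (rx ∷ _)   (there x∈)  (here refl) = inj₂ (inj₂ (All.lookup rx x∈))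
AllPairs-compare (_  ∷ rxs) (there x∈)  (there y∈)  = AllPairs-compare rxs x∈ y∈

-- Unions, differences and intersections of finite sets.

x∈p─q⇒x∉q : ∀ {m} (p q : Subset m) {x} → x ∈ p ─ q → x ∉ q
x∈p─q⇒x∉q (_ ∷ _) (outside ∷ _) here        ()
x∈p─q⇒x∉q (_ ∷ p) (_       ∷ q) (there x∈─) (there x∈q) = x∈p─q⇒x∉q p q x∈─ x∈q

module _ {m : ℕ} where

  private variable
    p q r : Subset m

  disjoint⇒∉ : p ∩ q ≡ ⊥ → ∀ {x} → x ∈ p → x ∉ q
  disjoint⇒∉ p∩q≡⊥ x∈p x∈q = ∉⊥ (subst (_ ∈_) p∩q≡⊥ (x∈p∩q⁺ (x∈p , x∈q)))

  ∉⇒disjoint : (∀ {x} → x ∈ p → x ∉ q) → p ∩ q ≡ ⊥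
  ∉⇒disjoint {p} {q} p∉q =
    Empty-unique λ (_ , x∈p∩q) → uncurry p∉q (x∈p∩q⁻ p q x∈p∩q)

  ≡⊥⊎⊥⊂ : (p : Subset m) → p ≡ ⊥ ⊎ ⊥ ⊂ p
  ≡⊥⊎⊥⊂ p with nonempty? p
  ... | yes (x , x∈p) = inj₂ (⊆-min p , x , x∈p , ∉⊥)
  ... | no  p-empty   = inj₁ (Empty-unique p-empty)

  ∪-least : p ⊆ r → q ⊆ r → p ∪ q ⊆ r
  ∪-least {p} {q = q} p⊆r q⊆r = [ p⊆r , q⊆r ]′ ∘ x∈p∪q⁻ p q

  ─-disjoint : ∀ p q → (p ─ q) ∩ q ≡ ⊥ {m}
  ─-disjoint p q = ∉⇒disjoint (x∈p─q⇒x∉q p q)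

  ─-monoˡ : p ⊆ q → p ─ r ⊆ q ─ r
  ─-monoˡ {p} {r = r} p⊆q x∈ =
    x∈p∧x∉q⇒x∈p─q (p⊆q (p─q⊆p p r x∈)) (x∈p─q⇒x∉q p r x∈)

  ─-distribʳ-∩ : ∀ p q r → (p ∩ q) ─ r ≡ (p ─ r) ∩ (q ─ r)
  ─-distribʳ-∩ p q r = ⊆-antisym
    (λ x∈ → x∈p∩q⁺ (─-monoˡ (p∩q⊆p p q) x∈ , ─-monoˡ (p∩q⊆q p q) x∈))
    (λ x∈ → let x∈p─r , x∈q─r = x∈p∩q⁻ (p ─ r) (q ─ r) x∈ in
      x∈p∧x∉q⇒x∈p─q (x∈p∩q⁺ (p─q⊆p p r x∈p─r , p─q⊆p q r x∈q─r)) (x∈p─q⇒x∉q p r x∈p─r))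

  p─q∪q≡p : q ⊆ p → (p ─ q) ∪ q ≡ p
  p─q∪q≡p {q} {p} q⊆p = ⊆-antisym (∪-least (p─q⊆p p q) q⊆p) p⊆
    where
    p⊆ : p ⊆ (p ─ q) ∪ q
    p⊆ {x} x∈p with x ∈? q
    ... | yes x∈q = x∈p∪q⁺ (inj₂ x∈q)
    ... | no  x∉q = x∈p∪q⁺ (inj₁ (x∈p∧x∉q⇒x∈p─q x∈p x∉q))

  p∪q─q≡p : p ∩ q ≡ ⊥ → (p ∪ q) ─ q ≡ p
  p∪q─q≡p {p} {q} p∩q≡⊥ = ⊆-antisym
    (λ x∈ → [ (λ x∈p → x∈p) , (λ x∈q → contradiction x∈q (x∈p─q⇒x∉q (p ∪ q) q x∈)) ]′
              (x∈p∪q⁻ p q (p─q⊆p (p ∪ q) q x∈)))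
    (λ x∈p → x∈p∧x∉q⇒x∈p─q (p⊆p∪q q x∈p) (disjoint⇒∉ p∩q≡⊥ x∈p))

  ∪-monoˡ : p ⊆ q → p ∪ r ⊆ q ∪ r
  ∪-monoˡ {p} {q} {r} p⊆q = ∪-least (p⊆p∪q r ∘ p⊆q) (q⊆p∪q q r)

  -- The witness of strictness lies in `q`, so disjointness keeps it out of `r`.
  ∪-monoˡ-⊂ : q ∩ r ≡ ⊥ → p ⊂ q → p ∪ r ⊂ q ∪ r
  ∪-monoˡ-⊂ {r = r} {p} q∩r≡⊥ (p⊆q , x , x∈q , x∉p) =
    ∪-monoˡ p⊆q , x , p⊆p∪q r x∈q , [ x∉p , disjoint⇒∉ q∩r≡⊥ x∈q ]′ ∘ x∈p∪q⁻ p r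

  ─-monoˡ-⊂ : r ⊆ p → p ⊂ q → p ─ r ⊂ q ─ r
  ─-monoˡ-⊂ {r} {p} r⊆p (p⊆q , x , x∈q , x∉p) =
    ─-monoˡ p⊆q , x , x∈p∧x∉q⇒x∈p─q x∈q (x∉p ∘ r⊆p) , x∉p ∘ p─q⊆p p r

  ⋂-lower : ∀ {ps} → p ∈ˡ ps → ⋂ ps ⊆ p
  ⋂-lower {ps = q ∷ ps} (here refl) = p∩q⊆p q (⋂ ps)
  ⋂-lower {ps = q ∷ ps} (there p∈)  = ⋂-lower p∈ ∘ p∩q⊆q q (⋂ ps)

  ⋂-∪ : ∀ (r : Subset m) ps → ⋂ (map (_∪ r) ps) ≡ ⋂ ps ∪ r
  ⋂-∪ r []       = sym (∪-zeroˡ r)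
  ⋂-∪ r (p ∷ ps) = trans (cong ((p ∪ r) ∩_) (⋂-∪ r ps)) (sym (∪-distribʳ-∩ r p (⋂ ps)))

  -- The list is taken non-empty because the empty intersection is the full set, which would lose
  -- `r`.
  ⋂-─ : ∀ (r : Subset m) p ps → ⋂ (map (_─ r) (p ∷ ps)) ≡ ⋂ (p ∷ ps) ─ r
  ⋂-─ r p []       = trans (∩-identityʳ (p ─ r)) (cong (_─ r) (sym (∩-identityʳ p)))
  ⋂-─ r p (q ∷ ps) =
    trans (cong ((p ─ r) ∩_) (⋂-─ r q ps)) (sym (─-distribʳ-∩ p (⋂ (q ∷ ps)) r))

-- Realizations and deformation retracts.

Realization-mono : ∀ {m} (Z K : Complex m) → Z ⊑ K → ∀ {x} → Realization Z x → Realization K x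
Realization-mono Z K Z⊑K (x≥0 , sum≈1 , support) = x≥0 , sum≈1 , λ τ τ>0 → Z⊑K (support τ τ>0)

-- Coordinates stay the same and only membership proofs are exchanged, so every condition on `H`
-- carries over.
StrongDeformationRetract-respʳ : ∀ {m} {A X Y : Subspace m} →
  (∀ {x} → X x → Y x) → (∀ {x} → Y x → X x) →
  StrongDeformationRetract A X → StrongDeformationRetract A Y
StrongDeformationRetract-respʳ {X = X} {Y} X⇒Y Y⇒X D = record
  { A⊆X        = X⇒Y ∘ D.A⊆X
  ; H          = λ p → let y , y∈X = D.H (cyl p) in y , X⇒Y y∈X
  ; continuous = λ p ε ε>0 → let δ , δ>0 , close = D.continuous (cyl p) ε ε>0 in
                             δ , δ>0 , λ q → close (cyl q)
  ; start      = λ p → D.start (cyl p)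
  ; end        = λ p → D.end (cyl p)
  ; fixed      = λ p → D.fixed (cyl p)
  }
  where
  module D = StrongDeformationRetract D

  cyl : Point (Cylinder Y) → Point (Cylinder X)
  cyl (x , t∈I , y∈Y) = x , t∈I , Y⇒X y∈Y

-- Chains of face simplices.

module _ {m} (K : Complex m) where

  -- Putting `⊥` in front of the non-empty members of `c` gives a chain containing `c`; by
  -- maximality its members lie in `c`.
  ⊥∈maximalChain : ∀ {c} → FaceSimplex K ⊥ → MaximalChain K c → ⊥ ∈ˡ c
  ⊥∈maximalChain {c} ⊥-face ((faces , increasing) , maximal) =
    maximal d (⊥-face ∷ All.filter⁺ (⊥ ⊂?_) faces ,
               All.all-filter (⊥ ⊂?_) c ∷ AllPairs.filter⁺ (⊥ ⊂?_) increasing)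
              c⊆d (here refl)
    where
    d : List (Subset m)
    d = ⊥ ∷ filter (⊥ ⊂?_) c

    c⊆d : c ListSubset.⊆ d
    c⊆d {τ} τ∈c with ≡⊥⊎⊥⊂ τ
    ... | inj₁ refl = here refl
    ... | inj₂ ⊥⊂τ  = there (∈-filter⁺ (⊥ ⊂?_) τ∈c ⊥⊂τ)

  -- Saturation is tested against every chain `d` through `c` and `σ`, the form in which maximality
  -- of a concatenated chain uses it.
  SaturatedBelow : Subset m → List (Subset m) → Set
  SaturatedBelow σ c = ∀ {d ρ} → Chain K d → c ListSubset.⊆ d → σ ∈ˡ d →
    ρ ∈ˡ d → ρ ⊂ σ → ρ ∈ˡ c

  -- Each covering step in the derivation of the rank appends the covered face. The top `σ` is left
  -- out, hence length `k` and not `k + 1`.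
  saturatedChain : ∀ {σ k} → HasRank K σ k →
    ∃ λ c → length c ≡ k × Chain K c × All (_⊂ σ) c × SaturatedBelow σ c
  saturatedChain rank-∅ =
    [] , refl , ([] , []) , [] , λ { _ _ _ _ (_ , _ , x∈⊥ , _) → contradiction x∈⊥ ∉⊥ }
  saturatedChain {τ} (rank-suc {ρ} {k = k} rank (ρ-face , _ , ρ⊂τ , nothing-between))
    with c , refl , (faces , increasing) , c⊂ρ , saturated ← saturatedChain rank =
      c ∷ʳ ρ
    , trans (length-++ c) (ℕ.+-comm (length c) 1)
    , ( All.++⁺ faces (ρ-face ∷ [])
      , AllPairs.++⁺ increasing ([] ∷ []) (All.map (_∷ []) c⊂ρ))
    , All.++⁺ (All.map (λ υ⊂ρ → ⊂-trans υ⊂ρ ρ⊂τ) c⊂ρ) (ρ⊂τ ∷ [])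
    , saturated′
    where
    -- Members below `ρ` are handled by induction; the covering relation excludes any strictly
    -- between `ρ` and `τ`.
    saturated′ : SaturatedBelow τ (c ∷ʳ ρ)
    saturated′ d-chain c⊆d τ∈d υ∈d υ⊂τ
      with AllPairs-compare (proj₂ d-chain) υ∈d (c⊆d (∈-++⁺ʳ c (here refl)))
    ... | inj₁ υ⊂ρ         =
      ∈-++⁺ˡ (saturated d-chain (c⊆d ∘ ∈-++⁺ˡ) (c⊆d (∈-++⁺ʳ c (here refl))) υ∈d υ⊂ρ)
    ... | inj₂ (inj₁ refl) = ∈-++⁺ʳ c (here refl)
    ... | inj₂ (inj₂ ρ⊂υ)  =
      contradiction (ρ⊂υ , υ⊂τ) (nothing-between (All.lookup (proj₁ d-chain) υ∈d))

-- Faces of the link and faces of `K` containing `σ`.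

module Link {m} (K : Complex m) {σ : Subset m} (σ∈K : Simplex K σ) where

  L : Complex m
  L = link K σ σ∈K

  restrict-simplex : ∀ {ρ} → Simplex K ρ → σ ⊆ ρ → Simplex L (ρ ─ σ)
  restrict-simplex {ρ} ρ∈K σ⊆ρ =
    ─-disjoint ρ σ , subst (Simplex K) (sym (p─q∪q≡p σ⊆ρ)) ρ∈K

  -- A simplex of `K` above `τ ∪ σ` contains `σ`, so removing `σ` gives a simplex of the link above
  -- `τ`.
  extend-maximal : ∀ {τ} → Maximal L τ → Maximal K (τ ∪ σ)
  extend-maximal {τ} ((τ∩σ≡⊥ , τ∪σ∈K) , maximal) = τ∪σ∈K , λ {υ} υ∈K τ∪σ⊆υ →
    let σ⊆υ : σ ⊆ υ
        σ⊆υ = τ∪σ⊆υ ∘ q⊆p∪q τ σ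
        τ⊆υ─σ : τ ⊆ υ ─ σ
        τ⊆υ─σ x∈τ = x∈p∧x∉q⇒x∈p─q (τ∪σ⊆υ (p⊆p∪q σ x∈τ)) (disjoint⇒∉ τ∩σ≡⊥ x∈τ)
    in trans (sym (p─q∪q≡p σ⊆υ)) (cong (_∪ σ) (maximal (restrict-simplex υ∈K σ⊆υ) τ⊆υ─σ))

  restrict-maximal : ∀ {ρ} → Maximal K ρ → σ ⊆ ρ → Maximal L (ρ ─ σ)
  restrict-maximal {ρ} (ρ∈K , maximal) σ⊆ρ =
    restrict-simplex ρ∈K σ⊆ρ , λ {τ} (τ∩σ≡⊥ , τ∪σ∈K) ρ─σ⊆τ →
      trans (sym (p∪q─q≡p τ∩σ≡⊥))
        (cong (_─ σ) (maximal τ∪σ∈K (subst (_⊆ τ ∪ σ) (p─q∪q≡p σ⊆ρ) (∪-monoˡ ρ─σ⊆τ))))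

  extend-face : ∀ {τ} → FaceSimplex L τ → FaceSimplex K (τ ∪ σ)
  extend-face τ-face = record
    { simplex        = proj₂ (simplex τ-face)
    ; σ₁             = σ₁ τ-face ∪ σ
    ; σs             = map (_∪ σ) (σs τ-face)
    ; all-maximal    = All.gmap⁺ extend-maximal (all-maximal τ-face)
    ; isIntersection = trans (cong (_∪ σ) (isIntersection τ-face))
                             (sym (⋂-∪ σ (σ₁ τ-face ∷ σs τ-face)))
    }

  -- If an intersection contains `σ`, so does each of its terms; hence every maximal simplex
  -- involved restricts to a maximal simplex of the link.
  restrict-face : ∀ {ρ} → FaceSimplex K ρ → σ ⊆ ρ → FaceSimplex L (ρ ─ σ)
  restrict-face {ρ} ρ-face σ⊆ρ = record
    { simplex        = restrict-simplex (simplex ρ-face) σ⊆ρ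
    ; σ₁             = σ₁ ρ-face ─ σ
    ; σs             = map (_─ σ) (σs ρ-face)
    ; all-maximal    = All.map⁺ (All.tabulate λ τ∈ →
        restrict-maximal (All.lookup (all-maximal ρ-face) τ∈)
          (⋂-lower τ∈ ∘ subst (σ ⊆_) (isIntersection ρ-face) σ⊆ρ))
    ; isIntersection = trans (cong (_─ σ) (isIntersection ρ-face))
                             (sym (⋂-─ σ (σ₁ ρ-face) (σs ρ-face)))
    }

  extend-chain : ∀ {c} → Chain L c → Chain K (map (_∪ σ) c)
  extend-chain (faces , increasing) =
      All.gmap⁺ extend-face faces
    , AllPairs-map⁺ (λ _ υ-face → ∪-monoˡ-⊂ (proj₁ (simplex υ-face))) faces increasing

  restrict-chain : ∀ {c} → All (σ ⊆_) c → Chain K c → Chain L (map (_─ σ) c)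
  restrict-chain σ⊆c (faces , increasing) =
      All.map⁺ (All.zipWith {Q = σ ⊆_} (uncurry restrict-face) (faces , σ⊆c))
    , AllPairs-map⁺ {P = σ ⊆_} (λ σ⊆ρ _ → ─-monoˡ-⊂ σ⊆ρ) σ⊆c increasing

  -- A face strictly between the extended ones would contain `σ`, and its restriction would lie
  -- strictly between `ρ` and `τ`.
  extend-covers : ∀ {ρ τ} → Covers L ρ τ → Covers K (ρ ∪ σ) (τ ∪ σ)
  extend-covers {ρ} {τ} (ρ-face , τ-face , ρ⊂τ , nothing-between) =
      extend-face ρ-face
    , extend-face τ-face
    , ∪-monoˡ-⊂ τ∩σ≡⊥ ρ⊂τ
    , λ {υ} υ-face (ρ∪σ⊂υ , υ⊂τ∪σ) →
        let σ⊆υ : σ ⊆ υ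
            σ⊆υ = p⊂q⇒p⊆q ρ∪σ⊂υ ∘ q⊆p∪q ρ σ in
        nothing-between (restrict-face υ-face σ⊆υ)
          ( subst (_⊂ υ ─ σ) (p∪q─q≡p ρ∩σ≡⊥) (─-monoˡ-⊂ (q⊆p∪q ρ σ) ρ∪σ⊂υ)
          , subst (υ ─ σ ⊂_) (p∪q─q≡p τ∩σ≡⊥) (─-monoˡ-⊂ σ⊆υ υ⊂τ∪σ))
    where
    ρ∩σ≡⊥ = proj₁ (simplex ρ-face)
    τ∩σ≡⊥ = proj₁ (simplex τ-face)

  -- Covering steps from `⊥` to `τ` in the link become steps from `σ` to `τ ∪ σ`, continuing the `k`
  -- steps up to `σ`.
  extend-rank : ∀ {k} → HasRank K σ k → ∀ {τ j} → HasRank L τ j → HasRank K (τ ∪ σ) (k ℕ.+ j)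
  extend-rank {k} rank-σ rank-∅ =
    subst₂ (HasRank K) (sym (∪-identityˡ σ)) (sym (ℕ.+-identityʳ k)) rank-σ
  extend-rank {k} rank-σ (rank-suc {k = j} rank-ρ covers) =
    subst (HasRank K _) (sym (ℕ.+-suc k j))
      (rank-suc (extend-rank rank-σ rank-ρ) (extend-covers covers))

  ∅-face-link : FaceSimplex K σ → FaceSimplex L ⊥
  ∅-face-link σ-face = subst (FaceSimplex L) σ─σ≡⊥ (restrict-face σ-face ⊆-refl)
    where
    σ─σ≡⊥ : σ ─ σ ≡ ⊥
    σ─σ≡⊥ = trans (cong (_─ σ) (sym (∪-identityˡ σ))) (p∪q─q≡p (∩-zeroˡ σ))

  -- Gradedness of the link.

  ∈-extend : ∀ {ρ c} → σ ⊆ ρ → ρ ─ σ ∈ˡ c → ρ ∈ˡ map (_∪ σ) c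
  ∈-extend σ⊆ρ ρ─σ∈c = subst (_∈ˡ _) (p─q∪q≡p σ⊆ρ) (∈-map⁺ (_∪ σ) ρ─σ∈c)

  -- The members of `d` containing `σ` restrict to a chain of the link that includes `c`, so
  -- maximality of `c` leaves nothing new.
  extend-saturated : ∀ {c d ρ} → MaximalChain L c → Chain K d →
    map (_∪ σ) c ListSubset.⊆ d → ρ ∈ˡ d → σ ⊆ ρ → ρ ∈ˡ map (_∪ σ) c
  extend-saturated {c} {d} ((faces , _) , maximal) (d-faces , d-increasing) c⊆d ρ∈d σ⊆ρ =
    ∈-extend σ⊆ρ
      (maximal e (restrict-chain (All.all-filter (σ ⊆?_) d)
                   (All.filter⁺ (σ ⊆?_) d-faces , AllPairs.filter⁺ (σ ⊆?_) d-increasing))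
        c⊆e (∈-e ρ∈d σ⊆ρ))
    where
    e : List (Subset m)
    e = map (_─ σ) (filter (σ ⊆?_) d)

    ∈-e : ∀ {ρ} → ρ ∈ˡ d → σ ⊆ ρ → ρ ─ σ ∈ˡ e
    ∈-e ρ∈d σ⊆ρ = ∈-map⁺ (_─ σ) (∈-filter⁺ (σ ⊆?_) ρ∈d σ⊆ρ)

    c⊆e : c ListSubset.⊆ e
    c⊆e {τ} τ∈c =
      subst (_∈ˡ e) (p∪q─q≡p (proj₁ (simplex (All.lookup faces τ∈c))))
        (∈-e (c⊆d (∈-map⁺ (_∪ σ) τ∈c)) (q⊆p∪q τ σ))

  graded-link : ∀ {n k} → FaceSimplex K σ → HasRank K σ k → Graded K n → Graded L (n ∸ k)
  graded-link {n} {k} σ-face rank-σ graded c c-maximal@(c-chain , _)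
    with p , refl , (p-faces , p-increasing) , p⊂σ , p-saturated ← saturatedChain K rank-σ =
    length-c (⊥∈maximalChain L (∅-face-link σ-face) c-maximal)
             (trans (sym (trans (length-++ p) (cong (length p ℕ.+_) (length-map (_∪ σ) c))))
                    (graded (p ++ c̃) (chain , maximal)))
    where
    c̃ : List (Subset m)
    c̃ = map (_∪ σ) c

    -- Since `∸` truncates, the count needs `length p` to be at most `n`; the member `⊥` makes the
    -- chain non-empty and so ensures this.
    length-c : ∀ {c} → ⊥ ∈ˡ c → length p ℕ.+ length c ≡ suc n → length c ≡ suc (n ∸ length p)
    length-c {_ ∷ c} _ eq = cong suc (begin
      length c                             ≡⟨ ℕ.m+n∸m≡n (length p) (length c) ⟨
      length p ℕ.+ length c ∸ length p
        ≡⟨ cong (_∸ length p) (ℕ.suc-injective (trans (sym (ℕ.+-suc (length p) (length c))) eq)) ⟩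
      n ∸ length p                         ∎)
      where open ≡-Reasoning

    σ∈c̃ : σ ∈ˡ c̃
    σ∈c̃ = subst (_∈ˡ c̃) (∪-identityˡ σ)
      (∈-map⁺ (_∪ σ) (⊥∈maximalChain L (∅-face-link σ-face) c-maximal))

    chain : Chain K (p ++ c̃)
    chain =
        All.++⁺ p-faces (proj₁ (extend-chain c-chain))
      , AllPairs.++⁺ p-increasing (proj₂ (extend-chain c-chain))
          (All.map (λ ρ⊂σ → All.map⁺ (All.tabulate λ {τ} _ → ⊂-⊆-trans ρ⊂σ (q⊆p∪q τ σ))) p⊂σ)

    -- The member `σ` splits `d`: saturation of `p` handles what lies below it, maximality of `c`
    -- what lies above.
    maximal : ∀ d → Chain K d → p ++ c̃ ListSubset.⊆ d → d ListSubset.⊆ p ++ c̃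
    maximal d d-chain pc̃⊆d ρ∈d
      with AllPairs-compare (proj₂ d-chain) ρ∈d (pc̃⊆d (∈-++⁺ʳ p σ∈c̃))
    ... | inj₁ ρ⊂σ         =
      ∈-++⁺ˡ (p-saturated d-chain (pc̃⊆d ∘ ∈-++⁺ˡ) (pc̃⊆d (∈-++⁺ʳ p σ∈c̃)) ρ∈d ρ⊂σ)
    ... | inj₂ (inj₁ refl) = ∈-++⁺ʳ p σ∈c̃
    ... | inj₂ (inj₂ σ⊂ρ)  =
      ∈-++⁺ʳ p (extend-saturated c-maximal d-chain (pc̃⊆d ∘ ∈-++⁺ʳ p) ρ∈d (p⊂q⇒p⊆q σ⊂ρ))

  -- Links inside the link.

  module _ {τ} (τ∈L : Simplex L τ) where

    link-link⊑link-∪ : link L τ τ∈L ⊑ link K (τ ∪ σ) (proj₂ τ∈L)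
    link-link⊑link-∪ {ρ} (ρ∩τ≡⊥ , ρ∪τ∩σ≡⊥ , ρ∪τ∪σ∈K) =
        ∉⇒disjoint (λ x∈ρ → [ disjoint⇒∉ ρ∩τ≡⊥ x∈ρ , disjoint⇒∉ ρ∪τ∩σ≡⊥ (p⊆p∪q τ x∈ρ) ]′
                              ∘ x∈p∪q⁻ τ σ)
      , subst (Simplex K) (∪-assoc ρ τ σ) ρ∪τ∪σ∈K

    link-∪⊑link-link : link K (τ ∪ σ) (proj₂ τ∈L) ⊑ link L τ τ∈L
    link-∪⊑link-link {ρ} (ρ∩[τ∪σ]≡⊥ , ρ∪τ∪σ∈K) =
        ∉⇒disjoint (λ x∈ρ → ρ∉ x∈ρ ∘ p⊆p∪q σ)
      , ∉⇒disjoint ([ (λ x∈ρ → ρ∉ x∈ρ ∘ q⊆p∪q τ σ) , disjoint⇒∉ (proj₁ τ∈L) ]′ ∘ x∈p∪q⁻ ρ τ)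
      , subst (Simplex K) (sym (∪-assoc ρ τ σ)) ρ∪τ∪σ∈K
      where
      ρ∉ : ∀ {x} → x ∈ ρ → x ∉ τ ∪ σ
      ρ∉ = disjoint⇒∉ ρ∩[τ∪σ]≡⊥

proposition4 : ∀ {m : ℕ} (K : Complex m) (n k : ℕ) (σ : Subset m) →
    IsPComplex K n →
    (σ-face : FaceSimplex K σ) →
    HasRank K σ k →
    IsPComplex (link K σ (FaceSimplex.simplex σ-face)) (n ∸ k)
proposition4 K n k σ K-P σ-face rank-σ = record
  { ∅-face = ∅-face-link σ-face
  ; graded = graded-link σ-face rank-σ (IsPComplex.graded K-P)
  ; sphere = λ {τ} {j} τ-face rank-τ →
      let τ∈L   = simplex τ-face
          L-τ   = link (link K σ (simplex σ-face)) τ τ∈L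
          K-τ∪σ = link K (τ ∪ σ) (proj₂ τ∈L)
          Z , Z⊑K-τ∪σ , homeo , retract =
            IsPComplex.sphere K-P (extend-face τ-face) (extend-rank rank-σ rank-τ)
      in Z
       , link-∪⊑link-link τ∈L ∘ Z⊑K-τ∪σ
       -- The sphere of `τ ∪ σ` has index `n ∸ (k + j)`, which equals `(n ∸ k) ∸ j` even under
       -- truncation.
       , subst (Homeomorphism (Realization Z) ∘ UnitSphere) (sym (ℕ.∸-+-assoc n k j)) homeo
       -- The two links have the same simplices but differ as records, so the retraction is
       -- transported along both inclusions.
       , StrongDeformationRetract-respʳ
           (Realization-mono K-τ∪σ L-τ (link-∪⊑link-link τ∈L))
           (Realization-mono L-τ K-τ∪σ (link-link⊑link-∪ τ∈L))
           retract
  }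
  where open Link K (simplex σ-face)
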